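{- Let $\rho\ge1$ be real. Every knapsack system $(S,\mathcal{I})$ with ratio bound $\rho$ is a $\lceil\rho\rceil$-growth system.
   Context: Knapsack system: $S$ is a finite (nonempty) set, $s:S\to\mathbb{R}_{\ge0}$, and $\mathcal{I}=\{I\subseteq S:\sum_{e\in I}s(e)\le1\}$. It has ratio bound $\rho$ if $\max_{e\in S}s(e)=\rho\cdot\min_{e\in S}s(e)$. $k$-growth system ($k$ a positive integer): an independence system $(S,\mathcal{I})$ (finite $S$, nonempty downward-closed $\mathcal{I}\subseteq2^S$) such that for all $X\subseteq S$ and all $I\in\mathcal{I}$ there is a partition $(Q,Z)$ of $I\setminus X$ with $|Z|\le k|X\setminus I|$ such that $P\cup Q\in\mathcal{I}$ for every basis $P$ of $X$, where a basis of $X$ is an inclusion-wise maximal independent subset of $X$. -}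

module Defs where

open import Data.Bool.Base using (true; false)
open import Data.Fin.Base using (Fin; zero; suc)
open import Data.Fin.Subset using (Subset; _⊆_; _∪_; _∩_; _─_; ⊥; ∣_∣)
open import Data.Integer.Base as ℤ using (ℤ)
open import Data.Nat.Base as ℕ using (ℕ; zero; suc)
import Data.Nat.Properties as ℕ
open import Data.Product.Base using (_×_; _,_; ∃-syntax)
open import Data.Rational.Base as ℚ using (ℚ; 0ℚ; 1ℚ; ½)
import Data.Rational.Properties as ℚ
open import Data.Rational.Solver using (module +-*-Solver)
open import Data.Sum.Base using (inj₁; inj₂)
open import Data.Vec.Base using ([]; _∷_)
open import Function.Base using (_∘_)
open import Level using (0ℓ)
open import Relation.Binary.PropositionalEquality
open import Relation.Unary using (Pred; Satisfiable)

-- The reals are Cauchy sequences of rationals.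
-- Equality of reals is the relation _≃_ below, not _≡_.

Eventually : Pred ℕ 0ℓ → Set
Eventually P = ∃[ N ] ∀ n → N ℕ.≤ n → P n

Cauchy : (ℕ → ℚ) → Set
Cauchy x = ∀ ε → 0ℚ ℚ.< ε →
  ∃[ N ] ∀ m n → N ℕ.≤ m → N ℕ.≤ n → ℚ.∣ x m ℚ.- x n ∣ ℚ.< ε

record ℝ : Set where
  constructor mkℝ
  field
    seq    : ℕ → ℚ
    cauchy : Cauchy seq

open ℝ public

infix 4 _≃_ _≤_

_≃_ : ℝ → ℝ → Set
x ≃ y = ∀ ε → 0ℚ ℚ.< ε → Eventually λ n → ℚ.∣ seq x n ℚ.- seq y n ∣ ℚ.< ε

_≤_ : ℝ → ℝ → Set
x ≤ y = ∀ ε → 0ℚ ℚ.< ε → Eventually λ n → seq x n ℚ.< seq y n ℚ.+ ε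

sub-add : ∀ p q → q ℚ.+ (p ℚ.- q) ≡ p
sub-add = solve 2 (λ p q → q :+ (p :- q) := p) refl
  where open +-*-Solver

add-sub : ∀ q ε → (q ℚ.+ ε) ℚ.- q ≡ ε
add-sub = solve 2 (λ q ε → (q :+ ε) :- q := ε) refl
  where open +-*-Solver

neg-sub : ∀ p q → ℚ.- (p ℚ.- q) ≡ q ℚ.- p
neg-sub = solve 2 (λ p q → :- (p :- q) := q :- p) refl
  where open +-*-Solver

p≤∣p∣ : ∀ p → p ℚ.≤ ℚ.∣ p ∣
p≤∣p∣ p with ℚ.≤-total 0ℚ p
... | inj₁ 0≤p = ℚ.≤-reflexive (sym (ℚ.0≤p⇒∣p∣≡p 0≤p))
... | inj₂ p≤0 = ℚ.≤-trans p≤0 (ℚ.0≤∣p∣ p)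

∣-∣<⇒< : ∀ {p q ε} → ℚ.∣ p ℚ.- q ∣ ℚ.< ε → p ℚ.< q ℚ.+ ε
∣-∣<⇒< {p} {q} {ε} h = subst (ℚ._< q ℚ.+ ε) (sub-add p q)
  (ℚ.+-monoʳ-< q (ℚ.≤-<-trans (p≤∣p∣ (p ℚ.- q)) h))

<⇒-< : ∀ {p q ε} → p ℚ.< q ℚ.+ ε → p ℚ.- q ℚ.< ε
<⇒-< {p} {q} {ε} h = subst (p ℚ.- q ℚ.<_) (add-sub q ε) (ℚ.+-monoˡ-< (ℚ.- q) h)

<⇒∣-∣< : ∀ {p q ε} → p ℚ.< q ℚ.+ ε → q ℚ.< p ℚ.+ ε → ℚ.∣ p ℚ.- q ∣ ℚ.< ε
<⇒∣-∣< {p} {q} {ε} h h′ with ℚ.∣p∣≡p∨∣p∣≡-p (p ℚ.- q)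
... | inj₁ e = subst (ℚ._< ε) (sym e) (<⇒-< {p} {q} h)
... | inj₂ e = subst (ℚ._< ε) (sym (trans e (neg-sub p q))) (<⇒-< {q} {p} h′)

_CloseTo_within_ : (ℕ → ℚ) → ℕ → ℚ → Set
x CloseTo N within ε = ∀ m n → N ℕ.≤ m → N ℕ.≤ n → x m ℚ.< x n ℚ.+ ε

cauchy₁ : ∀ x ε → 0ℚ ℚ.< ε → ∃[ N ] seq x CloseTo N within ε
cauchy₁ x ε 0<ε =
  let (N , h) = cauchy x ε 0<ε
  in N , λ m n N≤m N≤n → ∣-∣<⇒< {seq x m} {seq x n} (h m n N≤m N≤n)

mkCauchy : ∀ {x} → (∀ ε → 0ℚ ℚ.< ε → ∃[ N ] x CloseTo N within ε) → Cauchy x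
mkCauchy {x} h ε 0<ε =
  let (N , c) = h ε 0<ε
  in N , λ m n N≤m N≤n → <⇒∣-∣< {x m} {x n} (c m n N≤m N≤n) (c n m N≤n N≤m)

cauchy₂ : ∀ x y (_∙_ : ℚ → ℚ → ℚ) δ ε → 0ℚ ℚ.< δ →
          (∀ a b c d → a ℚ.< c ℚ.+ δ → b ℚ.< d ℚ.+ δ → (a ∙ b) ℚ.< (c ∙ d) ℚ.+ ε) →
          ∃[ N ] (λ n → seq x n ∙ seq y n) CloseTo N within ε
cauchy₂ x y _∙_ δ ε 0<δ h =
  let (M , f) = cauchy₁ x δ 0<δ
      (N , g) = cauchy₁ y δ 0<δ
  in M ℕ.⊔ N , λ m n hm hn →
  h (seq x m) (seq y m) (seq x n) (seq y n)
    (f m n (ℕ.m⊔n≤o⇒m≤o M N hm) (ℕ.m⊔n≤o⇒m≤o M N hn))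
    (g m n (ℕ.m⊔n≤o⇒n≤o M N hm) (ℕ.m⊔n≤o⇒n≤o M N hn))

0<½* : ∀ {ε} → 0ℚ ℚ.< ε → 0ℚ ℚ.< ½ ℚ.* ε
0<½* {ε} 0<ε = subst (ℚ._< ½ ℚ.* ε) (ℚ.*-zeroʳ ½) (ℚ.*-monoʳ-<-pos ½ 0<ε)

halves : ∀ c d ε → (c ℚ.+ ½ ℚ.* ε) ℚ.+ (d ℚ.+ ½ ℚ.* ε) ≡ (c ℚ.+ d) ℚ.+ ε
halves = solve 3 (λ c d ε → (c :+ con ½ :* ε) :+ (d :+ con ½ :* ε) := (c :+ d) :+ ε) refl
  where open +-*-Solver

⊔-close : ∀ ε a b c d → a ℚ.< c ℚ.+ ε → b ℚ.< d ℚ.+ ε →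
          a ℚ.⊔ b ℚ.< (c ℚ.⊔ d) ℚ.+ ε
⊔-close ε a b c d h h′ with ℚ.⊔-sel a b
... | inj₁ e = subst (ℚ._< (c ℚ.⊔ d) ℚ.+ ε) (sym e) (ℚ.<-≤-trans h (ℚ.+-monoˡ-≤ ε (ℚ.p≤p⊔q c d)))
... | inj₂ e = subst (ℚ._< (c ℚ.⊔ d) ℚ.+ ε) (sym e) (ℚ.<-≤-trans h′ (ℚ.+-monoˡ-≤ ε (ℚ.p≤q⊔p c d)))

⊓-close : ∀ ε a b c d → a ℚ.< c ℚ.+ ε → b ℚ.< d ℚ.+ ε →
          a ℚ.⊓ b ℚ.< (c ℚ.⊓ d) ℚ.+ ε
⊓-close ε a b c d h h′ with ℚ.⊓-sel c d
... | inj₁ e = subst (λ z → a ℚ.⊓ b ℚ.< z ℚ.+ ε) (sym e) (ℚ.≤-<-trans (ℚ.p⊓q≤p a b) h)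
... | inj₂ e = subst (λ z → a ℚ.⊓ b ℚ.< z ℚ.+ ε) (sym e) (ℚ.≤-<-trans (ℚ.p⊓q≤q a b) h′)

-- A Cauchy sequence is eventually bounded by a positive rational.
bound : ∀ x → ∃[ B ] 0ℚ ℚ.< B × Eventually (λ n → ℚ.∣ seq x n ∣ ℚ.≤ B)
bound x =
  let (N , h) = cauchy x 1ℚ (ℚ.positive⁻¹ 1ℚ)
      xN      = seq x N
  in ℚ.∣ xN ∣ ℚ.+ 1ℚ
   , ℚ.+-mono-≤-< (ℚ.0≤∣p∣ xN) (ℚ.positive⁻¹ 1ℚ)
   , N , λ n N≤n → subst (λ z → ℚ.∣ z ∣ ℚ.≤ ℚ.∣ xN ∣ ℚ.+ 1ℚ) (sub-add (seq x n) xN)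
       (ℚ.≤-trans (ℚ.∣p+q∣≤∣p∣+∣q∣ xN (seq x n ℚ.- xN))
         (ℚ.+-monoʳ-≤ ℚ.∣ xN ∣ (ℚ.<⇒≤ (h n N N≤n ℕ.≤-refl))))

*-split : ∀ a b c d → a ℚ.* (b ℚ.- d) ℚ.+ d ℚ.* (a ℚ.- c) ≡ a ℚ.* b ℚ.- c ℚ.* d
*-split = solve 4 (λ a b c d → a :* (b :- d) :+ d :* (a :- c) := a :* b :- c :* d) refl
  where open +-*-Solver

∣*∣< : ∀ {p q B δ} → 0ℚ ℚ.< B → ℚ.∣ p ∣ ℚ.≤ B → ℚ.∣ q ∣ ℚ.< δ → ℚ.∣ p ℚ.* q ∣ ℚ.< B ℚ.* δ
∣*∣< {p} {q} {B} {δ} 0<B hp hq = subst (ℚ._< B ℚ.* δ) (sym (ℚ.∣p*q∣≡∣p∣*∣q∣ p q))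
  (ℚ.≤-<-trans (ℚ.*-monoʳ-≤-nonNeg ℚ.∣ q ∣ {{ℚ.∣-∣-nonNeg q}} hp)
               (ℚ.*-monoʳ-<-pos B {{ℚ.positive 0<B}} hq))

*-close : ∀ {a b c d B C δ} → 0ℚ ℚ.< B → 0ℚ ℚ.< C → ℚ.∣ a ∣ ℚ.≤ B → ℚ.∣ d ∣ ℚ.≤ C →
          ℚ.∣ a ℚ.- c ∣ ℚ.< δ → ℚ.∣ b ℚ.- d ∣ ℚ.< δ →
          ℚ.∣ a ℚ.* b ℚ.- c ℚ.* d ∣ ℚ.< (B ℚ.+ C) ℚ.* δ
*-close {a} {b} {c} {d} {B} {C} {δ} 0<B 0<C ha hd hac hbd =
  subst₂ ℚ._<_ (cong ℚ.∣_∣ (*-split a b c d)) (sym (ℚ.*-distribʳ-+ δ B C))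
    (ℚ.≤-<-trans (ℚ.∣p+q∣≤∣p∣+∣q∣ (a ℚ.* (b ℚ.- d)) (d ℚ.* (a ℚ.- c)))
      (ℚ.+-mono-< (∣*∣< {a} {b ℚ.- d} 0<B ha hbd) (∣*∣< {d} {a ℚ.- c} 0<C hd hac)))

divide : ∀ D ε → 0ℚ ℚ.< D → 0ℚ ℚ.< ε → ∃[ δ ] 0ℚ ℚ.< δ × D ℚ.* δ ≡ ε
divide D ε 0<D 0<ε = D⁻¹ ℚ.* ε
  , subst (ℚ._< D⁻¹ ℚ.* ε) (ℚ.*-zeroʳ D⁻¹)
      (ℚ.*-monoʳ-<-pos D⁻¹ {{ℚ.1/pos⇒pos D {{ℚ.positive 0<D}}}} 0<ε)
  , trans (sym (ℚ.*-assoc D D⁻¹ ε))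
      (trans (cong (ℚ._* ε) (ℚ.*-inverseʳ D {{ℚ.>-nonZero 0<D}})) (ℚ.*-identityˡ ε))
  where D⁻¹ = (ℚ.1/ D) {{ℚ.>-nonZero 0<D}}

*-cauchy : ∀ x y → Cauchy (λ n → seq x n ℚ.* seq y n)
*-cauchy x y ε 0<ε =
  let (B , 0<B , K , hB) = bound x
      (C , 0<C , L , hC) = bound y
      (δ , 0<δ , e)      = divide (B ℚ.+ C) ε (ℚ.+-mono-< 0<B 0<C) 0<ε
      (M , f)            = cauchy x δ 0<δ
      (N , g)            = cauchy y δ 0<δ
  in (K ℕ.⊔ L) ℕ.⊔ (M ℕ.⊔ N) , λ m n hm hn →
  let KL≤m = ℕ.m⊔n≤o⇒m≤o (K ℕ.⊔ L) (M ℕ.⊔ N) hm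
      KL≤n = ℕ.m⊔n≤o⇒m≤o (K ℕ.⊔ L) (M ℕ.⊔ N) hn
      MN≤m = ℕ.m⊔n≤o⇒n≤o (K ℕ.⊔ L) (M ℕ.⊔ N) hm
      MN≤n = ℕ.m⊔n≤o⇒n≤o (K ℕ.⊔ L) (M ℕ.⊔ N) hn
  in subst (ℚ.∣ seq x m ℚ.* seq y m ℚ.- seq x n ℚ.* seq y n ∣ ℚ.<_) e
       (*-close {seq x m} {seq y m} {seq x n} {seq y n} 0<B 0<C
         (hB m (ℕ.m⊔n≤o⇒m≤o K L KL≤m)) (hC n (ℕ.m⊔n≤o⇒n≤o K L KL≤n))
         (f m n (ℕ.m⊔n≤o⇒m≤o M N MN≤m) (ℕ.m⊔n≤o⇒m≤o M N MN≤n))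
         (g m n (ℕ.m⊔n≤o⇒n≤o M N MN≤m) (ℕ.m⊔n≤o⇒n≤o M N MN≤n)))

fromℚ : ℚ → ℝ
fromℚ p = mkℝ (λ _ → p) λ ε 0<ε → 0 , λ _ _ _ _ →
  subst (λ z → ℚ.∣ z ∣ ℚ.< ε) (sym (ℚ.+-inverseʳ p)) 0<ε

fromℤ : ℤ → ℝ
fromℤ i = fromℚ (i ℚ./ 1)

0ℝ 1ℝ : ℝ
0ℝ = fromℚ 0ℚ
1ℝ = fromℚ 1ℚ

infixl 6 _+_ _⊔_
infixl 7 _*_ _⊓_

_+_ : ℝ → ℝ → ℝ
x + y = mkℝ (λ n → seq x n ℚ.+ seq y n) (mkCauchy λ ε 0<ε →
  cauchy₂ x y ℚ._+_ (½ ℚ.* ε) ε (0<½* 0<ε) λ a b c d h h′ →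
    subst (a ℚ.+ b ℚ.<_) (halves c d ε) (ℚ.+-mono-< h h′))

_*_ : ℝ → ℝ → ℝ
x * y = mkℝ (λ n → seq x n ℚ.* seq y n) (*-cauchy x y)

_⊔_ : ℝ → ℝ → ℝ
x ⊔ y = mkℝ (λ n → seq x n ℚ.⊔ seq y n) (mkCauchy λ ε 0<ε →
  cauchy₂ x y ℚ._⊔_ ε ε 0<ε (⊔-close ε))

_⊓_ : ℝ → ℝ → ℝ
x ⊓ y = mkℝ (λ n → seq x n ℚ.⊓ seq y n) (mkCauchy λ ε 0<ε →
  cauchy₂ x y ℚ._⊓_ ε ε 0<ε (⊓-close ε))

-- k = ⌈ρ⌉, the least integer that is at least ρ.  This is a relation because
-- the ceiling of a real is not a computable function.
IsCeiling : ℝ → ℤ → Set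
IsCeiling ρ k = ρ ≤ fromℤ k × (∀ j → ρ ≤ fromℤ j → k ℤ.≤ j)

∑[_]_ : ∀ {n} → Subset n → (Fin n → ℝ) → ℝ
∑[ []        ] f = 0ℝ
∑[ true  ∷ I ] f = f zero + ∑[ I ] (f ∘ suc)
∑[ false ∷ I ] f = ∑[ I ] (f ∘ suc)

max : ∀ {n} → (Fin (suc n) → ℝ) → ℝ
max {zero}  f = f zero
max {suc n} f = f zero ⊔ max (f ∘ suc)

min : ∀ {n} → (Fin (suc n) → ℝ) → ℝ
min {zero}  f = f zero
min {suc n} f = f zero ⊓ min (f ∘ suc)

record IsIndependenceSystem {n} (𝓘 : Pred (Subset n) 0ℓ) : Set where
  field
    nonempty       : Satisfiable 𝓘
    downwardClosed : ∀ {I J} → J ⊆ I → 𝓘 I → 𝓘 J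

record IsBasis {n} (𝓘 : Pred (Subset n) 0ℓ) (X P : Subset n) : Set where
  field
    P⊆X         : P ⊆ X
    independent : 𝓘 P
    maximal     : ∀ {P′} → P′ ⊆ X → 𝓘 P′ → P ⊆ P′ → P′ ≡ P

-- Either part may be empty.
record IsPartition {n} (Y Q Z : Subset n) : Set where
  field
    covers   : Q ∪ Z ≡ Y
    disjoint : Q ∩ Z ≡ ⊥

record IsGrowthSystem (k : ℕ) {n} (𝓘 : Pred (Subset n) 0ℓ) : Set where
  field
    k-positive           : 0 ℕ.< k
    isIndependenceSystem : IsIndependenceSystem 𝓘
    growth : ∀ X I → 𝓘 I → ∃[ Q ] ∃[ Z ]
      IsPartition (I ─ X) Q Z
      × ∣ Z ∣ ℕ.≤ k ℕ.* ∣ X ─ I ∣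
      × (∀ P → IsBasis 𝓘 X P → 𝓘 (P ∪ Q))

record KnapsackSystem (n : ℕ) : Set where
  field
    size        : Fin (suc n) → ℝ
    size-nonNeg : ∀ e → 0ℝ ≤ size e

  Independent : Pred (Subset (suc n)) 0ℓ
  Independent I = ∑[ I ] size ≤ 1ℝ

  HasRatioBound : ℝ → Set
  HasRatioBound ρ = max size ≃ ρ * min size

{-# OPTIONS --safe #-}

-- If I is independent and k |J ─ I| ≤ |I ─ J|, then J is independent, since
--   s(J ─ I) ≤ |J ─ I| max s ≤ |J ─ I| k min s ≤ |I ─ J| min s ≤ s(I ─ J).
-- For the growth property let Z be any set of k |X ─ I| elements of I ─ X (all
-- of I ─ X if there are fewer), and apply this to J = P ∪ Q.
module Submission where

open import Defs
open import Data.Bool.Base using (true; false)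
open import Data.Fin.Base using (Fin; zero; suc)
open import Data.Fin.Subset using (Subset; _∈_; _∉_; _⊆_; _∪_; _∩_; _─_; ⊥; ∣_∣)
open import Data.Fin.Subset.Properties
open import Data.Integer.Base as ℤ using (+_)
import Data.Integer.Properties as ℤ
open import Data.Nat.Base as ℕ using (ℕ; zero; suc; z≤n; s≤s)
import Data.Nat.Properties as ℕ
open import Data.Product.Base using (_×_; _,_; ∃-syntax)
open import Data.Rational.Base as ℚ using (ℚ; 0ℚ; 1ℚ; ½)
import Data.Rational.Properties as ℚ
open import Data.Rational.Solver using (module +-*-Solver)
import Data.Rational.Unnormalised.Base as ℚᵘ
import Data.Rational.Unnormalised.Properties as ℚᵘ
open import Data.Sum.Base using (inj₁; inj₂; [_,_]′)
open import Data.Vec.Base using ([]; _∷_; here; there)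
open import Function.Base using (_∘_)
open import Level using (0ℓ)
open import Relation.Binary.Bundles using (Preorder)
open import Relation.Binary.PropositionalEquality
open import Relation.Nullary.Negation using (contradiction)

-- For a variable `n` the normalisation in `ℚ./` is stuck, so the identity is checked on
-- unnormalised fractions, where all denominators are 1.
suc/1≡1+/1 : ∀ n → (+ suc n) ℚ./ 1 ≡ 1ℚ ℚ.+ (+ n) ℚ./ 1
suc/1≡1+/1 n = ℚ.toℚᵘ-injective (begin
  ℚ.toℚᵘ ((+ suc n) ℚ./ 1)             ≈⟨ ℚ.toℚᵘ-fromℚᵘ (ℚᵘ.mkℚᵘ (+ suc n) 0) ⟩
  ℚᵘ.mkℚᵘ (+ suc n) 0                  ≈⟨ ℚᵘ.*≡* (cong (λ i → (+ 1 ℤ.+ i) ℤ.* + 1) (sym (ℤ.*-identityʳ (+ n)))) ⟩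
  ℚᵘ.1ℚᵘ ℚᵘ.+ ℚᵘ.mkℚᵘ (+ n) 0          ≈⟨ ℚᵘ.+-congʳ ℚᵘ.1ℚᵘ (ℚᵘ.≃-sym (ℚ.toℚᵘ-fromℚᵘ (ℚᵘ.mkℚᵘ (+ n) 0))) ⟩
  ℚᵘ.1ℚᵘ ℚᵘ.+ ℚ.toℚᵘ ((+ n) ℚ./ 1)     ≈⟨ ℚᵘ.≃-sym (ℚ.toℚᵘ-homo-+ 1ℚ ((+ n) ℚ./ 1)) ⟩
  ℚ.toℚᵘ (1ℚ ℚ.+ (+ n) ℚ./ 1)          ∎)
  where open import Relation.Binary.Reasoning.Setoid ℚᵘ.≃-setoid

-- Order and arithmetic of the reals

pointwise : ∀ {x y} → (∀ j → seq x j ℚ.≤ seq y j) → x ≤ y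
pointwise {x} {y} h ε 0<ε = 0 , λ j _ → ℚ.≤-<-trans (h j)
  (subst (ℚ._< seq y j ℚ.+ ε) (ℚ.+-identityʳ (seq y j)) (ℚ.+-monoʳ-< (seq y j) 0<ε))

+-mono-≤ : ∀ {x y u v} → x ≤ y → u ≤ v → x + u ≤ y + v
+-mono-≤ {x} {y} {u} {v} x≤y u≤v ε 0<ε =
  let (M , f) = x≤y (½ ℚ.* ε) (0<½* 0<ε)
      (N , g) = u≤v (½ ℚ.* ε) (0<½* 0<ε)
  in M ℕ.⊔ N , λ j h →
  subst (seq x j ℚ.+ seq u j ℚ.<_) (halves (seq y j) (seq v j) ε)
    (ℚ.+-mono-< (f j (ℕ.m⊔n≤o⇒m≤o M N h)) (g j (ℕ.m⊔n≤o⇒n≤o M N h)))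

≤-trans : ∀ {x y z} → x ≤ y → y ≤ z → x ≤ z
≤-trans {x} {y} {z} x≤y y≤z ε 0<ε =
  let (M , f) = x≤y (½ ℚ.* ε) (0<½* 0<ε)
      (N , g) = y≤z (½ ℚ.* ε) (0<½* 0<ε)
  in M ℕ.⊔ N , λ j h →
  subst (seq x j ℚ.<_) (regroup (seq z j) ε)
    (ℚ.<-trans (f j (ℕ.m⊔n≤o⇒m≤o M N h))
      (ℚ.+-monoˡ-< (½ ℚ.* ε) (g j (ℕ.m⊔n≤o⇒n≤o M N h))))
  where
  regroup : ∀ q ε → (q ℚ.+ ½ ℚ.* ε) ℚ.+ ½ ℚ.* ε ≡ q ℚ.+ ε
  regroup = solve 2 (λ q ε → (q :+ con ½ :* ε) :+ con ½ :* ε := q :+ ε) refl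
    where open +-*-Solver

infix 4 _≈_

-- Termwise equality, finer than `_≃_`: the algebraic identities below follow from ring laws of `ℚ`
-- at each index, with no `ε`.
_≈_ : ℝ → ℝ → Set
x ≈ y = ∀ j → seq x j ≡ seq y j

≤-preorder : Preorder 0ℓ 0ℓ 0ℓ
≤-preorder = record
  { Carrier    = ℝ
  ; _≈_        = _≈_
  ; _≲_        = _≤_
  ; isPreorder = record
    { isEquivalence = record
      { refl  = λ _ → refl
      ; sym   = λ e j → sym (e j)
      ; trans = λ e e′ j → trans (e j) (e′ j)
      }
    ; reflexive = λ {x} {y} e → pointwise {x} {y} (ℚ.≤-reflexive ∘ e)
    ; trans     = λ {x} {y} {z} → ≤-trans {x} {y} {z}
    }
  }

open import Relation.Binary.Reasoning.Preorder ≤-preorder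

≤-refl : ∀ {x} → x ≤ x
≤-refl {x} = pointwise {x} {x} (λ _ → ℚ.≤-refl)

≃⇒≤ : ∀ {x y} → x ≃ y → x ≤ y
≃⇒≤ {x} {y} x≃y ε 0<ε =
  let (N , h) = x≃y ε 0<ε in N , λ j N≤j → ∣-∣<⇒< {seq x j} {seq y j} (h j N≤j)

⊓-glb : ∀ {x y z} → x ≤ y → x ≤ z → x ≤ y ⊓ z
⊓-glb {x} {y} {z} x≤y x≤z ε 0<ε =
  let (M , f) = x≤y ε 0<ε
      (N , g) = x≤z ε 0<ε
  in M ℕ.⊔ N , λ j h →
  -- Reading `x` as `x ⊓ x` makes this an instance of `⊓-close`.
  subst (ℚ._< (seq y j ℚ.⊓ seq z j) ℚ.+ ε) (ℚ.⊓-idem (seq x j))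
    (⊓-close ε (seq x j) (seq x j) (seq y j) (seq z j)
      (f j (ℕ.m⊔n≤o⇒m≤o M N h)) (g j (ℕ.m⊔n≤o⇒n≤o M N h)))

-- The sign of q decides which factor is estimated by δ.
*-nearNonPos : ∀ {p q A B δ} → 0ℚ ℚ.< A → 0ℚ ℚ.< B → 0ℚ ℚ.< δ →
               ℚ.∣ p ∣ ℚ.≤ A → ℚ.∣ q ∣ ℚ.≤ B →
               p ℚ.< 0ℚ ℚ.+ δ → 0ℚ ℚ.< q ℚ.+ δ → p ℚ.* q ℚ.< (A ℚ.+ B) ℚ.* δ
*-nearNonPos {p} {q} {A} {B} {δ} 0<A 0<B 0<δ hA hB p<δ -δ<q =
  subst (p ℚ.* q ℚ.<_) (sym (ℚ.*-distribʳ-+ δ A B)) ([ q-nonNeg , q-nonPos ]′ (ℚ.≤-total 0ℚ q))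
  where
  0<*δ : ∀ {C} → 0ℚ ℚ.< C → 0ℚ ℚ.< C ℚ.* δ
  0<*δ {C} 0<C = subst (ℚ._< C ℚ.* δ) (ℚ.*-zeroʳ C) (ℚ.*-monoʳ-<-pos C {{ℚ.positive 0<C}} 0<δ)

  q-nonNeg : 0ℚ ℚ.≤ q → p ℚ.* q ℚ.< A ℚ.* δ ℚ.+ B ℚ.* δ
  q-nonNeg 0≤q = ℚR.begin-strict
    p ℚ.* q                  ℚR.≤⟨ ℚ.*-monoʳ-≤-nonNeg q {{ℚ.nonNegative 0≤q}}
                                     (ℚ.<⇒≤ (subst (p ℚ.<_) (ℚ.+-identityˡ δ) p<δ)) ⟩
    δ ℚ.* q                  ℚR.≤⟨ ℚ.*-monoˡ-≤-nonNeg δ {{ℚ.nonNegative (ℚ.<⇒≤ 0<δ)}}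
                                     (ℚ.≤-trans (p≤∣p∣ q) hB) ⟩
    δ ℚ.* B                  ℚR.≡⟨ ℚ.*-comm δ B ⟩
    B ℚ.* δ                  ℚR.≡⟨ ℚ.+-identityˡ (B ℚ.* δ) ⟨
    0ℚ ℚ.+ B ℚ.* δ           ℚR.<⟨ ℚ.+-monoˡ-< (B ℚ.* δ) (0<*δ 0<A) ⟩
    A ℚ.* δ ℚ.+ B ℚ.* δ      ℚR.∎
    where module ℚR = ℚ.≤-Reasoning

  q-nonPos : q ℚ.≤ 0ℚ → p ℚ.* q ℚ.< A ℚ.* δ ℚ.+ B ℚ.* δ
  q-nonPos q≤0 = ℚR.begin-strict
    p ℚ.* q                  ℚR.≤⟨ p≤∣p∣ (p ℚ.* q) ⟩
    ℚ.∣ p ℚ.* q ∣            ℚR.<⟨ ∣*∣< {p} {q} 0<A hA ∣q∣<δ ⟩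
    A ℚ.* δ                  ℚR.≡⟨ ℚ.+-identityʳ (A ℚ.* δ) ⟨
    A ℚ.* δ ℚ.+ 0ℚ           ℚR.<⟨ ℚ.+-monoʳ-< (A ℚ.* δ) (0<*δ 0<B) ⟩
    A ℚ.* δ ℚ.+ B ℚ.* δ      ℚR.∎
    where
    module ℚR = ℚ.≤-Reasoning
    ∣q∣<δ : ℚ.∣ q ∣ ℚ.< δ
    ∣q∣<δ = subst (λ z → ℚ.∣ z ∣ ℚ.< δ) (ℚ.+-identityʳ q)
      (<⇒∣-∣< {q} {0ℚ} (ℚ.≤-<-trans q≤0 (subst (0ℚ ℚ.<_) (sym (ℚ.+-identityˡ δ)) 0<δ)) -δ<q)

-- The terms have the right signs only up to an error `δ`. Since the sequences are eventually
-- bounded by `A` and `B`, the product stays below `(A + B) δ`, and `δ` is chosen to make this `ε`.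
*-nonPos-nonNeg : ∀ {x y} → x ≤ 0ℝ → 0ℝ ≤ y → x * y ≤ 0ℝ
*-nonPos-nonNeg {x} {y} x≤0 0≤y ε 0<ε =
  let (A , 0<A , K , hA) = bound x
      (B , 0<B , L , hB) = bound y
      (δ , 0<δ , e)      = divide (A ℚ.+ B) ε (ℚ.+-mono-< 0<A 0<B) 0<ε
      (M , f)            = x≤0 δ 0<δ
      (N , g)            = 0≤y δ 0<δ
  in (K ℕ.⊔ L) ℕ.⊔ (M ℕ.⊔ N) , λ j h →
  let KL≤j = ℕ.m⊔n≤o⇒m≤o (K ℕ.⊔ L) (M ℕ.⊔ N) h
      MN≤j = ℕ.m⊔n≤o⇒n≤o (K ℕ.⊔ L) (M ℕ.⊔ N) h
  in subst (seq x j ℚ.* seq y j ℚ.<_) (trans e (sym (ℚ.+-identityˡ ε)))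
       (*-nearNonPos {seq x j} {seq y j} 0<A 0<B 0<δ
         (hA j (ℕ.m⊔n≤o⇒m≤o K L KL≤j)) (hB j (ℕ.m⊔n≤o⇒n≤o K L KL≤j))
         (f j (ℕ.m⊔n≤o⇒m≤o M N MN≤j)) (g j (ℕ.m⊔n≤o⇒n≤o M N MN≤j)))

-- Split `x` as `(x - q) + q`; the first part times `y` is at most 0. The bound `q` will be the
-- ceiling, so it can be rational, and `x - q` is then a sum with a constant sequence.
*-monoˡ-≤-fromℚ : ∀ {x y} q → x ≤ fromℚ q → 0ℝ ≤ y → x * y ≤ fromℚ q * y
*-monoˡ-≤-fromℚ {x} {y} q x≤q 0≤y = begin
  x * y                                          ≈⟨ (λ j → split (seq x j) (seq y j) q) ⟩
  (x + fromℚ (ℚ.- q)) * y + fromℚ q * y          ∼⟨ +-mono-≤ {(x + fromℚ (ℚ.- q)) * y} {0ℝ} {fromℚ q * y} {fromℚ q * y}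
                                                      (*-nonPos-nonNeg {x + fromℚ (ℚ.- q)} {y} x-q≤0 0≤y)
                                                      (≤-refl {fromℚ q * y}) ⟩
  0ℝ + fromℚ q * y                               ≈⟨ (λ j → ℚ.+-identityˡ (q ℚ.* seq y j)) ⟩
  fromℚ q * y                                    ∎
  where
  split : ∀ p r q → p ℚ.* r ≡ (p ℚ.+ ℚ.- q) ℚ.* r ℚ.+ q ℚ.* r
  split = solve 3 (λ p r q → p :* r := (p :+ (:- q)) :* r :+ q :* r) refl
    where open +-*-Solver

  x-q≤0 : x + fromℚ (ℚ.- q) ≤ 0ℝ
  x-q≤0 = begin
    x + fromℚ (ℚ.- q)           ∼⟨ +-mono-≤ {x} {fromℚ q} {fromℚ (ℚ.- q)} {fromℚ (ℚ.- q)}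
                                     x≤q (≤-refl {fromℚ (ℚ.- q)}) ⟩
    fromℚ q + fromℚ (ℚ.- q)     ≈⟨ (λ _ → ℚ.+-inverseʳ q) ⟩
    0ℝ                          ∎

1≰0 : 1ℝ ≤ 0ℝ → ∀ {A : Set} → A
-- With `ε` equal to 1 the hypothesis reads 1 < 0 + 1.
1≰0 1≤0 = let (N , h) = 1≤0 1ℚ (ℚ.positive⁻¹ 1ℚ) in
  contradiction (h N ℕ.≤-refl) (ℚ.<-irrefl refl)

-- Natural multiples of reals

infixr 8 _·_

-- Repeated addition, so that `∣ I ∣ · x` unfolds in step with `∑[ I ] f`; `fromℤ-*` links it to the
-- product of reals.
_·_ : ℕ → ℝ → ℝ
zero  · x = 0ℝ
suc n · x = x + n · x

fromℤ-* : ∀ n x → fromℤ (+ n) * x ≈ n · x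
fromℤ-* zero    x j = ℚ.*-zeroˡ (seq x j)
fromℤ-* (suc n) x j = trans (cong (ℚ._* seq x j) (suc/1≡1+/1 n))
  (trans (ℚ.*-distribʳ-+ (seq x j) 1ℚ ((+ n) ℚ./ 1))
    (cong₂ ℚ._+_ (ℚ.*-identityˡ (seq x j)) (fromℤ-* n x j)))

·-homo-+ : ∀ m n x → (m ℕ.+ n) · x ≈ m · x + n · x
·-homo-+ zero    n x j = sym (ℚ.+-identityˡ (seq (n · x) j))
·-homo-+ (suc m) n x j = trans (cong (seq x j ℚ.+_) (·-homo-+ m n x j))
  (sym (ℚ.+-assoc (seq x j) (seq (m · x) j) (seq (n · x) j)))

·-assoc : ∀ m n x → (m ℕ.* n) · x ≈ m · n · x
·-assoc zero    n x j = refl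
·-assoc (suc m) n x j = trans (·-homo-+ n (m ℕ.* n) x j) (cong (seq (n · x) j ℚ.+_) (·-assoc m n x j))

·-monoʳ-≤ : ∀ n {x y} → x ≤ y → n · x ≤ n · y
·-monoʳ-≤ zero            x≤y = ≤-refl {0ℝ}
·-monoʳ-≤ (suc n) {x} {y} x≤y = +-mono-≤ {x} {y} {n · x} {n · y} x≤y (·-monoʳ-≤ n {x} {y} x≤y)

·-monoˡ-≤ : ∀ {m n x} → 0ℝ ≤ x → m ℕ.≤ n → m · x ≤ n · x
·-monoˡ-≤ {n = zero}          0≤x z≤n       = ≤-refl {0ℝ}
·-monoˡ-≤ {n = suc n} {x = x} 0≤x z≤n       =
  +-mono-≤ {0ℝ} {x} {0ℝ} {n · x} 0≤x (·-monoˡ-≤ {n = n} {x} 0≤x z≤n)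
·-monoˡ-≤ {suc m} {suc n} {x} 0≤x (s≤s m≤n) =
  +-mono-≤ {x} {x} {m · x} {n · x} (≤-refl {x}) (·-monoˡ-≤ {m} {n} {x} 0≤x m≤n)

-- Maxima, minima and sums over subsets

≤max : ∀ {n} (f : Fin (suc n) → ℝ) e → f e ≤ max f
≤max {zero}  f zero    = ≤-refl {f zero}
≤max {suc n} f zero    = pointwise {f zero} {max f} (λ j → ℚ.p≤p⊔q (seq (f zero) j) _)
≤max {suc n} f (suc e) = begin
  f (suc e)      ∼⟨ ≤max (f ∘ suc) e ⟩
  max (f ∘ suc)  ∼⟨ pointwise {max (f ∘ suc)} {max f} (λ j → ℚ.p≤q⊔p (seq (f zero) j) _) ⟩
  max f          ∎

min≤ : ∀ {n} (f : Fin (suc n) → ℝ) e → min f ≤ f e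
min≤ {zero}  f zero    = ≤-refl {f zero}
min≤ {suc n} f zero    = pointwise {min f} {f zero} (λ j → ℚ.p⊓q≤p (seq (f zero) j) _)
min≤ {suc n} f (suc e) = begin
  min f          ∼⟨ pointwise {min f} {min (f ∘ suc)} (λ j → ℚ.p⊓q≤q (seq (f zero) j) _) ⟩
  min (f ∘ suc)  ∼⟨ min≤ (f ∘ suc) e ⟩
  f (suc e)      ∎

-- The bound is carried through each `⊓`, since an element attaining the minimum cannot be computed
-- for reals. With `x` equal to `0ℝ` it shows that the least size is nonnegative.
min-greatest : ∀ {n} {f : Fin (suc n) → ℝ} {x} → (∀ e → x ≤ f e) → x ≤ min f
min-greatest {zero}          h = h zero
min-greatest {suc n} {f} {x} h =
  ⊓-glb {x} {f zero} {min (f ∘ suc)} (h zero) (min-greatest {n} {f ∘ suc} {x} (h ∘ suc))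

∑≤∣∣· : ∀ {n} (I : Subset n) {f : Fin n → ℝ} {x} → (∀ e → f e ≤ x) → ∑[ I ] f ≤ ∣ I ∣ · x
∑≤∣∣· []                  h = ≤-refl {0ℝ}
∑≤∣∣· (true  ∷ I) {f} {x} h =
  +-mono-≤ {f zero} {x} {∑[ I ] (f ∘ suc)} {∣ I ∣ · x} (h zero) (∑≤∣∣· I {f ∘ suc} {x} (h ∘ suc))
∑≤∣∣· (false ∷ I) {f} {x} h = ∑≤∣∣· I {f ∘ suc} {x} (h ∘ suc)

∣∣·≤∑ : ∀ {n} (I : Subset n) {f : Fin n → ℝ} {x} → (∀ e → x ≤ f e) → ∣ I ∣ · x ≤ ∑[ I ] f
∣∣·≤∑ []                  h = ≤-refl {0ℝ}
∣∣·≤∑ (true  ∷ I) {f} {x} h =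
  +-mono-≤ {x} {f zero} {∣ I ∣ · x} {∑[ I ] (f ∘ suc)} (h zero) (∣∣·≤∑ I {f ∘ suc} {x} (h ∘ suc))
∣∣·≤∑ (false ∷ I) {f} {x} h = ∣∣·≤∑ I {f ∘ suc} {x} (h ∘ suc)

∑-⊥ : ∀ n {f : Fin n → ℝ} → ∑[ ⊥ ] f ≡ 0ℝ
∑-⊥ zero    = refl
∑-⊥ (suc n) = ∑-⊥ n

∑-∩-─ : ∀ {n} (I J : Subset n) f → ∑[ I ] f ≈ ∑[ I ∩ J ] f + ∑[ I ─ J ] f
∑-∩-─ []          []          f j = refl
∑-∩-─ (true  ∷ I) (true  ∷ J) f j = trans (cong (seq (f zero) j ℚ.+_) (∑-∩-─ I J (f ∘ suc) j))
  (sym (ℚ.+-assoc (seq (f zero) j) _ _))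
-- The head belongs to the second summand and has to move past the first.
∑-∩-─ (true  ∷ I) (false ∷ J) f j = trans (cong (seq (f zero) j ℚ.+_) (∑-∩-─ I J (f ∘ suc) j))
  (x+[y+z]≡y+[x+z] (seq (f zero) j) (seq (∑[ I ∩ J ] (f ∘ suc)) j) (seq (∑[ I ─ J ] (f ∘ suc)) j))
  where
  x+[y+z]≡y+[x+z] : ∀ x y z → x ℚ.+ (y ℚ.+ z) ≡ y ℚ.+ (x ℚ.+ z)
  x+[y+z]≡y+[x+z] = solve 3 (λ x y z → x :+ (y :+ z) := y :+ (x :+ z)) refl
    where open +-*-Solver
∑-∩-─ (false ∷ I) (true  ∷ J) f j = ∑-∩-─ I J (f ∘ suc) j
∑-∩-─ (false ∷ I) (false ∷ J) f j = ∑-∩-─ I J (f ∘ suc) j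

-- Finite subsets

x∈p─q⇒x∉q : ∀ {n x} (p q : Subset n) → x ∈ p ─ q → x ∉ q
x∈p─q⇒x∉q (true ∷ p) (false ∷ q) here        ()
x∈p─q⇒x∉q (_    ∷ p) (_     ∷ q) (there x∈)  (there x∈q) = x∈p─q⇒x∉q p q x∈ x∈q

p⊆q⇒∣p─q∣≡0 : ∀ {n} {p q : Subset n} → p ⊆ q → ∣ p ─ q ∣ ≡ 0
p⊆q⇒∣p─q∣≡0 {n} {p} {q} p⊆q = trans
  (cong ∣_∣ (Empty-unique λ (_ , x∈) → x∈p─q⇒x∉q p q x∈ (p⊆q (p─q⊆p p q x∈)))) (∣⊥∣≡0 n)

-- The first `c` elements of `Y` go to `Z`, all later ones to `Q`.
partition-by-size : ∀ {n} (Y : Subset n) c → c ℕ.≤ ∣ Y ∣ →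
                    ∃[ Q ] ∃[ Z ] IsPartition Y Q Z × ∣ Z ∣ ≡ c
partition-by-size [] zero z≤n = [] , [] , record { covers = refl ; disjoint = refl } , refl
partition-by-size (false ∷ Y) c c≤ =
  let (Q , Z , π , e) = partition-by-size Y c c≤
  in false ∷ Q , false ∷ Z
   , record { covers   = cong (false ∷_) (IsPartition.covers π)
            ; disjoint = cong (false ∷_) (IsPartition.disjoint π) } , e
partition-by-size (true ∷ Y) zero z≤n =
  let (Q , Z , π , e) = partition-by-size Y zero z≤n
  in true ∷ Q , false ∷ Z
   , record { covers   = cong (true ∷_) (IsPartition.covers π)
            ; disjoint = cong (false ∷_) (IsPartition.disjoint π) } , e
partition-by-size (true ∷ Y) (suc c) (s≤s c≤) =
  let (Q , Z , π , e) = partition-by-size Y c c≤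
  in false ∷ Q , true ∷ Z
   , record { covers   = cong (true ∷_) (IsPartition.covers π)
            ; disjoint = cong (false ∷_) (IsPartition.disjoint π) } , cong suc e

module _ {n} {X I P Q Z : Subset n} (P⊆X : P ⊆ X) (π : IsPartition (I ─ X) Q Z) where

  open IsPartition π

  -- Since `Q` lies inside `I`, anything of `P ∪ Q` outside `I` comes from `P`. This bounds what is
  -- gained in passing from `I` to `P ∪ Q`.
  ∪─⊆─ : (P ∪ Q) ─ I ⊆ X ─ I
  ∪─⊆─ x∈ = x∈p∧x∉q⇒x∈p─q ([ P⊆X , (λ x∈Q → contradiction (Q⊆I x∈Q) x∉I) ]′
                              (x∈p∪q⁻ P Q (p─q⊆p (P ∪ Q) I x∈))) x∉I
    where
    x∉I = x∈p─q⇒x∉q (P ∪ Q) I x∈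
    Q⊆I : Q ⊆ I
    Q⊆I x∈Q = p─q⊆p I X (subst (_ ∈_) covers (x∈p∪q⁺ (inj₁ x∈Q)))

  -- An element of `Z` is outside `X`, hence outside `P`, and disjointness keeps it out of `Q`. So
  -- at least `∣ Z ∣` elements of `I` are given up.
  Z⊆─∪ : Z ⊆ I ─ (P ∪ Q)
  Z⊆─∪ x∈Z = x∈p∧x∉q⇒x∈p─q (p─q⊆p I X x∈I─X) λ x∈P∪Q →
    [ (λ x∈P → x∈p─q⇒x∉q I X x∈I─X (P⊆X x∈P))
    , (λ x∈Q → ∉⊥ (subst (_ ∈_) disjoint (x∈p∩q⁺ (x∈Q , x∈Z))))
    ]′ (x∈p∪q⁻ P Q x∈P∪Q)
    where
    x∈I─X = subst (_ ∈_) covers (x∈p∪q⁺ (inj₂ x∈Z))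

-- Exchange in knapsack systems and the growth property

module _ {n} (K : KnapsackSystem n) (k : ℕ) where

  open KnapsackSystem K

  -- The two sums share the part over the intersection, so only the differences are compared. Both
  -- downward closure and growth are instances.
  independent-exchange : max size ≤ k · min size → ∀ {I J} →
                         k ℕ.* ∣ J ─ I ∣ ℕ.≤ ∣ I ─ J ∣ → Independent I → Independent J
  independent-exchange max≤ {I} {J} h I-ind = begin
    ∑[ J ] size                              ≈⟨ ∑-∩-─ J I size ⟩
    ∑[ J ∩ I ] size + ∑[ J ─ I ] size        ∼⟨ +-mono-≤ {∑[ J ∩ I ] size} {∑[ I ∩ J ] size}
                                                  {∑[ J ─ I ] size} {∑[ I ─ J ] size}
                                                  ∩-comm-≤ exchanged ⟩
    ∑[ I ∩ J ] size + ∑[ I ─ J ] size        ≈⟨ (λ j → sym (∑-∩-─ I J size j)) ⟩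
    ∑[ I ] size                              ∼⟨ I-ind ⟩
    1ℝ                                       ∎
    where
    ∩-comm-≤ : ∑[ J ∩ I ] size ≤ ∑[ I ∩ J ] size
    ∩-comm-≤ = subst (λ A → ∑[ J ∩ I ] size ≤ ∑[ A ] size) (∩-comm J I) (≤-refl {∑[ J ∩ I ] size})

    exchanged : ∑[ J ─ I ] size ≤ ∑[ I ─ J ] size
    exchanged = begin
      ∑[ J ─ I ] size                ∼⟨ ∑≤∣∣· (J ─ I) {size} {max size} (≤max size) ⟩
      ∣ J ─ I ∣ · max size           ∼⟨ ·-monoʳ-≤ ∣ J ─ I ∣ {max size} {k · min size} max≤ ⟩
      ∣ J ─ I ∣ · k · min size       ≈⟨ (λ j → sym (·-assoc ∣ J ─ I ∣ k (min size) j)) ⟩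
      -- Nonnegative sizes enter here: increasing the number of copies must not decrease the total.
      (∣ J ─ I ∣ ℕ.* k) · min size   ∼⟨ ·-monoˡ-≤ {∣ J ─ I ∣ ℕ.* k} {∣ I ─ J ∣} {min size}
                                          (min-greatest {f = size} {0ℝ} size-nonNeg)
                                          (subst (ℕ._≤ ∣ I ─ J ∣) (ℕ.*-comm k ∣ J ─ I ∣) h) ⟩
      ∣ I ─ J ∣ · min size           ∼⟨ ∣∣·≤∑ (I ─ J) {size} {min size} (min≤ size) ⟩
      ∑[ I ─ J ] size                ∎

  isIndependenceSystem : max size ≤ k · min size → IsIndependenceSystem Independent
  isIndependenceSystem max≤ = record
    { nonempty       = ⊥ , subst (_≤ 1ℝ) (sym (∑-⊥ (suc n) {size}))
                             (pointwise {0ℝ} {1ℝ} (λ _ → ℚ.nonNegative⁻¹ 1ℚ))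
    -- For `J ⊆ I` nothing is gained, so the counting condition is `k * 0 ≤ ∣ I ─ J ∣`.
    ; downwardClosed = λ {I} {J} J⊆I → independent-exchange max≤ {I} {J}
        (subst (ℕ._≤ ∣ I ─ J ∣) (sym (trans (cong (k ℕ.*_) (p⊆q⇒∣p─q∣≡0 J⊆I)) (ℕ.*-zeroʳ k))) z≤n)
    }

  growth : max size ≤ k · min size → ∀ X I → Independent I → ∃[ Q ] ∃[ Z ]
           IsPartition (I ─ X) Q Z
           × ∣ Z ∣ ℕ.≤ k ℕ.* ∣ X ─ I ∣
           × (∀ P → IsBasis Independent X P → Independent (P ∪ Q))
  growth max≤ X I I-ind with ℕ.≤-total (k ℕ.* ∣ X ─ I ∣) ∣ I ─ X ∣
  -- All of `I ─ X` fits into `Z`, which leaves only `P` itself to be independent.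
  ... | inj₂ small =
    ⊥ , I ─ X
    , record { covers = ∪-identityˡ (I ─ X) ; disjoint = ∩-zeroˡ (I ─ X) }
    , small
    , λ P basis → subst Independent (sym (∪-identityʳ P)) (IsBasis.independent basis)
  ... | inj₁ large =
    let (Q , Z , π , ∣Z∣≡) = partition-by-size (I ─ X) (k ℕ.* ∣ X ─ I ∣) large
    in Q , Z , π , ℕ.≤-reflexive ∣Z∣≡ , λ P basis →
    let P⊆X = IsBasis.P⊆X basis
    in independent-exchange max≤ {I} {P ∪ Q}
         -- With `J` for `P ∪ Q`: `k ∣ J ─ I ∣ ≤ k ∣ X ─ I ∣ = ∣ Z ∣ ≤ ∣ I ─ J ∣`.
         (ℕ.≤-trans (ℕ.*-monoʳ-≤ k (p⊆q⇒∣p∣≤∣q∣ (∪─⊆─ P⊆X π)))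
           (subst (ℕ._≤ ∣ I ─ (P ∪ Q) ∣) ∣Z∣≡ (p⊆q⇒∣p∣≤∣q∣ (Z⊆─∪ P⊆X π))))
         I-ind

theorem14 : ∀ (ρ : ℝ) → 1ℝ ≤ ρ →
    ∀ {n : ℕ} (K : KnapsackSystem n) → KnapsackSystem.HasRatioBound K ρ →
    ∀ (k : ℕ) → IsCeiling ρ (+ k) →
    IsGrowthSystem k (KnapsackSystem.Independent K)
theorem14 ρ 1≤ρ K ratio k (ρ≤k , _) = record
  { k-positive           = k-positive k ρ≤k
  ; isIndependenceSystem = isIndependenceSystem K k max≤
  ; growth               = growth K k max≤
  }
  where
  open KnapsackSystem K

  k-positive : ∀ k → ρ ≤ fromℤ (+ k) → 0 ℕ.< k
  -- A zero ceiling would give 1 ≤ `ρ` ≤ 0.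
  k-positive zero    ρ≤0 = 1≰0 (≤-trans {1ℝ} {ρ} {0ℝ} 1≤ρ ρ≤0)
  k-positive (suc _) _   = s≤s z≤n

  -- The ratio bound reaches the exchange argument only in this form, with the real `ρ` replaced by
  -- the natural number `k`.
  max≤ : max size ≤ k · min size
  max≤ = begin
    max size                ∼⟨ ≃⇒≤ {max size} {ρ * min size} ratio ⟩
    ρ * min size            ∼⟨ *-monoˡ-≤-fromℚ {ρ} {min size} ((+ k) ℚ./ 1) ρ≤k
                                 (min-greatest {f = size} {0ℝ} size-nonNeg) ⟩
    fromℤ (+ k) * min size  ≈⟨ fromℤ-* k (min size) ⟩
    k · min size            ∎
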